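{- Let $f,g:\{0,1\}^n\to\{0,1\}$ be Boolean functions and let $K$ be a nonnegative integer. If $f$ is PN-equivalent to $g$, then $AH({}^K\!SD^1(f))=AH({}^K\!SD^1(g))$.
   Context: For a word $x=(x_1,\dots,x_n)\in\{0,1\}^n$ and an index $i$, $x^i$ denotes the word obtained from $x$ by changing (flipping) its $i$-th bit. The (local) sensitivity of $f$ on $x$ is $s(f,x)=|\{i\in\{1,\dots,n\}: f(x)\neq f(x^i)\}|$. The $K$-1-sensitivity domain of $f$ is ${}^K\!SD^1(f)=\{x\in\{0,1\}^n: s(f,x)=K, f(x)=1\}$. The Hamming distance $h(x,y)$ of two words $x,y\in\{0,1\}^n$ is the number of bit positions in which they differ. The average Hamming distance of the domain is $$AH({}^K\!SD^1(f))=\frac{1}{N}\sum_{x,y\in {}^K\!SD^1(f)}h(x,y),$$ where $N=2^n$ is the total number of words. PN-equivalence: $f$ is PN-equivalent to $g$ if there exist a permutation $\pi$ of the $n$ coordinates (acting on words by permuting their bits) and, for each coordinate $j$, a choice of whether or not to negate it (written $(\neg)x_j$, the choice being independent of $x$), such that $f(\pi((\neg)x_1,(\neg)x_2,\dots,(\neg)x_n))=g(x_1,\dots,x_n)$ for all $x\in\{0,1\}^n$. -}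

module Defs where

open import Data.Bool using (Bool; true; false; not; if_then_else_; _≟_)
open import Data.Fin using (Fin)
open import Data.Fin.Permutation using (Permutation′; _⟨$⟩ʳ_)
open import Data.Integer using (+_)
open import Data.List using (List; []; _∷_; _++_; map; length; filter; allFin; sum; cartesianProduct)
open import Data.List.Membership.Propositional using (_∈_)
open import Data.List.Membership.Propositional.Properties using (∈-++⁺ˡ; ∈-++⁺ʳ; ∈-map⁺; ∈-map⁻)
open import Data.List.Relation.Unary.All using ([])
open import Data.List.Relation.Unary.AllPairs using ([]; _∷_)
open import Data.List.Relation.Unary.Any using (here)
open import Data.List.Relation.Unary.Unique.Propositional using (Unique)
open import Data.List.Relation.Unary.Unique.Propositional.Properties using (++⁺; map⁺)
open import Data.Nat using (ℕ; zero; suc; _^_)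
import Data.Nat as ℕ
open import Data.Nat.Properties using (m^n≢0)
open import Data.Product using (_×_; _,_; uncurry; ∃-syntax)
open import Data.Rational using (ℚ; _/_)
open import Data.Vec using (Vec; []; _∷_; lookup; tabulate; zipWith; _[_]%=_)
open import Data.Vec.Properties using (∷-injectiveʳ)
open import Relation.Binary.PropositionalEquality using (_≡_; refl)
open import Relation.Nullary using (¬?; _×-dec_)
open import Relation.Unary using (Decidable)

Word : ℕ → Set
Word n = Vec Bool n

BoolFun : ℕ → Set
BoolFun n = Word n → Bool

flipBit : ∀ {n} → Word n → Fin n → Word n
flipBit x i = x [ i ]%= not

sensitivity : ∀ {n} → BoolFun n → Word n → ℕ
sensitivity {n} f x =
  length (filter (λ i → ¬? (f x ≟ f (flipBit x i))) (allFin n))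

hamming : ∀ {n} → Word n → Word n → ℕ
hamming {n} x y =
  length (filter (λ i → ¬? (lookup x i ≟ lookup y i)) (allFin n))

-- The set {0,1}ⁿ as a list; words-complete and words-unique show that every
-- word occurs in it exactly once.
words : ∀ n → List (Word n)
words zero    = [] ∷ []
words (suc n) = map (false ∷_) (words n) ++ map (true ∷_) (words n)

words-complete : ∀ {n} (x : Word n) → x ∈ words n
words-complete []          = here refl
words-complete (false ∷ x) = ∈-++⁺ˡ (∈-map⁺ (false ∷_) (words-complete x))
words-complete {suc n} (true ∷ x) =
  ∈-++⁺ʳ (map (false ∷_) (words n)) (∈-map⁺ (true ∷_) (words-complete x))

words-unique : ∀ n → Unique (words n)
words-unique zero    = [] ∷ []
words-unique (suc n) =
  ++⁺ (map⁺ ∷-injectiveʳ (words-unique n))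
      (map⁺ ∷-injectiveʳ (words-unique n))
      λ { (p , q) → case-disjoint (∈-map⁻ (false ∷_) p) (∈-map⁻ (true ∷_) q) }
  where
  open import Data.Empty using (⊥)
  case-disjoint : ∀ {v} → ∃[ x ] (x ∈ words n × v ≡ false ∷ x) →
                  ∃[ y ] (y ∈ words n × v ≡ true ∷ y) → ⊥
  case-disjoint (_ , _ , refl) (_ , _ , ())

InSD¹ : ∀ {n} → ℕ → BoolFun n → Word n → Set
InSD¹ K f x = sensitivity f x ≡ K × f x ≡ true

inSD¹? : ∀ {n} (K : ℕ) (f : BoolFun n) → Decidable (InSD¹ K f)
inSD¹? K f x = (sensitivity f x ℕ.≟ K) ×-dec (f x ≟ true)

SD¹ : ∀ {n} → ℕ → BoolFun n → List (Word n)
SD¹ {n} K f = filter (inSD¹? K f) (words n)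

-- The sum runs over ordered pairs, and the divisor is the number 2ⁿ of all
-- words rather than the number of pairs in the domain.
averageHamming : ∀ {n} → List (Word n) → ℚ
averageHamming {n} D =
  _/_ (+ sum (map (uncurry hamming) (cartesianProduct D D))) (2 ^ n) {{m^n≢0 2 n}}

permuteBits : ∀ {n} → Permutation′ n → Word n → Word n
permuteBits π x = tabulate (λ i → lookup x (π ⟨$⟩ʳ i))

-- The bits negated are those at which c is true.
negateBits : ∀ {n} → Vec Bool n → Word n → Word n
negateBits = zipWith (λ c b → if c then not b else b)

PNEquivalent : ∀ {n} → BoolFun n → BoolFun n → Set
PNEquivalent {n} f g =
  ∃[ π ] ∃[ c ] ((x : Word n) → f (permuteBits π (negateBits c x)) ≡ g x)

{-# OPTIONS --safe #-}
-- If f ∘ φ = g, where φ permutes and negates coordinates, then φ is a bijection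
-- of {0,1}ⁿ preserving Hamming distance and commuting with bit flips up to the
-- permutation of the indices.  Hence it preserves sensitivity, maps the domain
-- of g onto that of f, and matches up the terms of the two sums of distances.
module Submission where

open import Defs
open import Data.Nat using (ℕ)
open import Relation.Binary.PropositionalEquality using (_≡_)

open import Data.Bool using (Bool; true; false; not; if_then_else_)
open import Data.Bool.Properties using (not-involutive)
open import Data.Fin using (Fin)
import Data.Fin as Fin
open import Data.Fin.Permutation using (Permutation′; flip; _⟨$⟩ʳ_; inverseˡ)
open import Data.Integer using (+_)
open import Data.List using (List; map; length; filter; allFin; cartesianProduct)
open import Data.List.Membership.Propositional using (_∈_)
open import Data.List.Membership.Propositional.Properties
  using (∈-map⁺; ∈-map⁻; ∈-filter⁺; ∈-filter⁻; ∈-allFin; ∈-cartesianProduct⁺; ∈-cartesianProduct⁻)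
open import Data.List.Membership.Propositional.Properties.WithK using (unique∧set⇒bag)
open import Data.List.Properties using (length-map; map-∘; map-cong)
open import Data.List.Relation.Binary.BagAndSetEquality using (∼bag⇒↭)
open import Data.List.Relation.Binary.Permutation.Propositional using (_↭_)
open import Data.List.Relation.Binary.Permutation.Propositional.Properties using (↭-length; map⁺)
open import Data.List.Relation.Unary.Unique.Propositional using (Unique)
import Data.List.Relation.Unary.Unique.Propositional.Properties as Unique
open import Data.Nat using (_^_)
open import Data.Nat.ListAction using (sum)
open import Data.Nat.ListAction.Properties using (sum-↭)
open import Data.Nat.Properties using (m^n≢0)
open import Data.Product using (_×_; _,_; uncurry)
open import Data.Product.Function.NonDependent.Propositional using (_×-↔_)
open import Data.Rational using (_/_)
open import Data.Vec using (Vec; lookup)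
open import Data.Vec.Properties
  using (lookup∘tabulate; tabulate∘lookup; tabulate-cong; lookup-zipWith; lookup∘updateAt; lookup∘updateAt′)
open import Function using (_∘_; _↔_; _⇔_; mk⇔; mk↔ₛ′; Inverse; Equivalence; Injection)
open import Function.Properties.Inverse using (↔⇒↣)
open import Relation.Binary.PropositionalEquality
  using (refl; sym; trans; cong; subst; _≢_; _≗_; module ≡-Reasoning)
open import Relation.Nullary using (yes; no)
open import Relation.Unary using (Decidable)

open ≡-Reasoning

-- Injectivity keeps the image list free of duplicates. In a duplicate-free list each membership has
-- only one proof, so having the same members already gives bag equality, and bag equality is
-- permutation.
map-↔-↭ : {A B : Set} (h : A ↔ B) {xs : List A} {ys : List B} →
  Unique xs → Unique ys →
  (∀ x → x ∈ xs ⇔ Inverse.to h x ∈ ys) → map (Inverse.to h) xs ↭ ys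
map-↔-↭ h {xs} {ys} xs! ys! xs⇔ys =
  ∼bag⇒↭ (unique∧set⇒bag (Unique.map⁺ (Injection.injective (↔⇒↣ h)) xs!) ys!
    λ {y} → mk⇔ into (from y))
  where
  open Inverse h using (to; strictlyInverseˡ) renaming (from to h⁻¹)
  into : ∀ {y} → y ∈ map to xs → y ∈ ys
  into y∈ with x , x∈xs , refl ← ∈-map⁻ to y∈ = Equivalence.to (xs⇔ys x) x∈xs
  from : ∀ y → y ∈ ys → y ∈ map to xs
  from y y∈ = subst (_∈ map to xs) (strictlyInverseˡ y)
    (∈-map⁺ to (Equivalence.from (xs⇔ys (h⁻¹ y))
      (subst (_∈ ys) (sym (strictlyInverseˡ y)) y∈)))

-- Because `xs` and `ys` contain everything, membership in a filtered list reduces to the predicate.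
-- This serves both for coordinates, listed by `allFin`, and for words.
∈-filter-⇔ : {A B : Set} {h : A → B} {P : A → Set} {Q : B → Set}
  (P? : Decidable P) (Q? : Decidable Q) {xs : List A} {ys : List B} →
  (∀ x → x ∈ xs) → (∀ y → y ∈ ys) → (∀ x → P x ⇔ Q (h x)) →
  ∀ x → x ∈ filter P? xs ⇔ h x ∈ filter Q? ys
∈-filter-⇔ P? Q? {xs} {ys} xs-all ys-all P⇔Q x = mk⇔
  (λ x∈ → let _ , px = ∈-filter⁻ P? {xs = xs} x∈ in
          ∈-filter⁺ Q? (ys-all _) (Equivalence.to (P⇔Q x) px))
  (λ y∈ → let _ , qy = ∈-filter⁻ Q? {xs = ys} y∈ in
          ∈-filter⁺ P? (xs-all _) (Equivalence.from (P⇔Q x) qy))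

-- The distance sum runs over ordered pairs, so the bijection is applied to both components at once.
cartesianProduct-↔-↭ : {A B : Set} (h : A ↔ B) {xs : List A} {ys : List B} →
  Unique xs → Unique ys → (∀ x → x ∈ xs ⇔ Inverse.to h x ∈ ys) →
  map (Inverse.to (h ×-↔ h)) (cartesianProduct xs xs) ↭ cartesianProduct ys ys
cartesianProduct-↔-↭ h {xs} {ys} xs! ys! xs⇔ys =
  map-↔-↭ (h ×-↔ h) (Unique.cartesianProduct⁺ xs! xs!) (Unique.cartesianProduct⁺ ys! ys!)
    λ { (x , y) → mk⇔
      (λ xy∈ → let x∈ , y∈ = ∈-cartesianProduct⁻ xs xs xy∈ in
               ∈-cartesianProduct⁺ (Equivalence.to (xs⇔ys x) x∈) (Equivalence.to (xs⇔ys y) y∈))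
      (λ xy∈ → let x∈ , y∈ = ∈-cartesianProduct⁻ ys ys xy∈ in
               ∈-cartesianProduct⁺ (Equivalence.from (xs⇔ys x) x∈) (Equivalence.from (xs⇔ys y) y∈)) }

-- Sensitivity and Hamming distance are both counts of coordinates, so this reindexing along `π`
-- yields the invariance of each.
count-permute : ∀ {n} (π : Permutation′ n) {P Q : Fin n → Set}
  (P? : Decidable P) (Q? : Decidable Q) → (∀ i → P i ⇔ Q (π ⟨$⟩ʳ i)) →
  length (filter P? (allFin n)) ≡ length (filter Q? (allFin n))
count-permute {n} π P? Q? P⇔Q = trans
  (sym (length-map (π ⟨$⟩ʳ_) (filter P? (allFin n))))
  (↭-length (map-↔-↭ π (Unique.filter⁺ P? (Unique.allFin⁺ n)) (Unique.filter⁺ Q? (Unique.allFin⁺ n))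
    (∈-filter-⇔ P? Q? ∈-allFin ∈-allFin P⇔Q)))

lookup-ext : ∀ {n} {A : Set} {x y : Vec A n} → lookup x ≗ lookup y → x ≡ y
lookup-ext {x = x} {y} eq =
  trans (sym (tabulate∘lookup x)) (trans (tabulate-cong eq) (tabulate∘lookup y))

-- This is the function inside `negateBits`, named so that its algebra can be used bitwise.
negateIf : Bool → Bool → Bool
negateIf c b = if c then not b else b

negateIf-involutive : ∀ c b → negateIf c (negateIf c b) ≡ b
negateIf-involutive true  b = not-involutive b
negateIf-involutive false b = refl

negateIf-injective : ∀ c {a b} → negateIf c a ≡ negateIf c b → a ≡ b
negateIf-injective c {a} {b} eq =
  trans (sym (negateIf-involutive c a)) (trans (cong (negateIf c) eq) (negateIf-involutive c b))

negateIf-not : ∀ c b → negateIf c (not b) ≡ not (negateIf c b)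
negateIf-not true  b = refl
negateIf-not false b = refl

lookup-negateBits : ∀ {n} (c : Vec Bool n) x i →
  lookup (negateBits c x) i ≡ negateIf (lookup c i) (lookup x i)
lookup-negateBits c x i = lookup-zipWith _ i c x

negateBits-involutive : ∀ {n} (c : Vec Bool n) x → negateBits c (negateBits c x) ≡ x
negateBits-involutive c x = lookup-ext λ i → begin
  lookup (negateBits c (negateBits c x)) i                ≡⟨ lookup-negateBits c (negateBits c x) i ⟩
  negateIf (lookup c i) (lookup (negateBits c x) i)       ≡⟨ cong (negateIf (lookup c i)) (lookup-negateBits c x i) ⟩
  negateIf (lookup c i) (negateIf (lookup c i) (lookup x i)) ≡⟨ negateIf-involutive (lookup c i) (lookup x i) ⟩
  lookup x i                                              ∎

lookup-permuteBits : ∀ {n} (π : Permutation′ n) x i →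
  lookup (permuteBits π x) i ≡ lookup x (π ⟨$⟩ʳ i)
lookup-permuteBits π x i = lookup∘tabulate _ i

permuteBits-flip : ∀ {n} (π : Permutation′ n) x → permuteBits π (permuteBits (flip π) x) ≡ x
permuteBits-flip π x = lookup-ext λ i → begin
  lookup (permuteBits π (permuteBits (flip π) x)) i ≡⟨ lookup-permuteBits π (permuteBits (flip π) x) i ⟩
  lookup (permuteBits (flip π) x) (π ⟨$⟩ʳ i)        ≡⟨ lookup-permuteBits (flip π) x (π ⟨$⟩ʳ i) ⟩
  lookup x (flip π ⟨$⟩ʳ (π ⟨$⟩ʳ i))                 ≡⟨ cong (lookup x) (inverseˡ π) ⟩
  lookup x i                                        ∎

module _ {n} (π : Permutation′ n) (c : Vec Bool n) where

  signedPermute : Word n → Word n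
  signedPermute x = permuteBits π (negateBits c x)

  -- The inverse undoes the permutation first and then negates with the same `c`, negation by a
  -- fixed mask being an involution.
  signedPermute-↔ : Word n ↔ Word n
  signedPermute-↔ = mk↔ₛ′ signedPermute (λ y → negateBits c (permuteBits (flip π) y))
    (λ y → trans (cong (permuteBits π) (negateBits-involutive c (permuteBits (flip π) y)))
                 (permuteBits-flip π y))
    -- `flip (flip π)` acts on indices as `π` by computation, so the same cancellation lemma covers
    -- the other order.
    (λ x → trans (cong (negateBits c) (permuteBits-flip (flip π) (negateBits c x)))
                 (negateBits-involutive c x))

  -- Negation precedes the permutation, so the mask is read at the source position `π ⟨$⟩ʳ i`.
  lookup-signedPermute : ∀ x i → lookup (signedPermute x) i ≡
    negateIf (lookup c (π ⟨$⟩ʳ i)) (lookup x (π ⟨$⟩ʳ i))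
  lookup-signedPermute x i =
    trans (lookup-permuteBits π (negateBits c x) i) (lookup-negateBits c x (π ⟨$⟩ʳ i))

  -- Bit `i` of the image is read from bit `π ⟨$⟩ʳ i` of `x`. There the flip commutes with the
  -- negation; at any other `j`, injectivity of `π` keeps the source bit away from the flipped one.
  flipBit-signedPermute : ∀ x i →
    flipBit (signedPermute x) i ≡ signedPermute (flipBit x (π ⟨$⟩ʳ i))
  flipBit-signedPermute x i = lookup-ext eq
    where
    eq : lookup (flipBit (signedPermute x) i) ≗ lookup (signedPermute (flipBit x (π ⟨$⟩ʳ i)))
    eq j with j Fin.≟ i
    ... | yes refl = begin
      lookup (flipBit (signedPermute x) i) i                   ≡⟨ lookup∘updateAt i (signedPermute x) ⟩
      not (lookup (signedPermute x) i)                         ≡⟨ cong not (lookup-signedPermute x i) ⟩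
      not (negateIf cᵢ (lookup x (π ⟨$⟩ʳ i)))                  ≡⟨ negateIf-not cᵢ _ ⟨
      negateIf cᵢ (not (lookup x (π ⟨$⟩ʳ i)))                  ≡⟨ cong (negateIf cᵢ) (lookup∘updateAt (π ⟨$⟩ʳ i) x) ⟨
      negateIf cᵢ (lookup (flipBit x (π ⟨$⟩ʳ i)) (π ⟨$⟩ʳ i))   ≡⟨ lookup-signedPermute (flipBit x (π ⟨$⟩ʳ i)) i ⟨
      lookup (signedPermute (flipBit x (π ⟨$⟩ʳ i))) i          ∎
      where cᵢ = lookup c (π ⟨$⟩ʳ i)
    ... | no j≢i = begin
      lookup (flipBit (signedPermute x) i) j                   ≡⟨ lookup∘updateAt′ j i j≢i (signedPermute x) ⟩
      lookup (signedPermute x) j                               ≡⟨ lookup-signedPermute x j ⟩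
      negateIf cⱼ (lookup x (π ⟨$⟩ʳ j))                        ≡⟨ cong (negateIf cⱼ) (lookup∘updateAt′ _ _ πj≢πi x) ⟨
      negateIf cⱼ (lookup (flipBit x (π ⟨$⟩ʳ i)) (π ⟨$⟩ʳ j))   ≡⟨ lookup-signedPermute (flipBit x (π ⟨$⟩ʳ i)) j ⟨
      lookup (signedPermute (flipBit x (π ⟨$⟩ʳ i))) j          ∎
      where
      cⱼ = lookup c (π ⟨$⟩ʳ j)
      πj≢πi : π ⟨$⟩ʳ j ≢ π ⟨$⟩ʳ i
      πj≢πi = j≢i ∘ Injection.injective (↔⇒↣ π)

  -- Both words undergo the same negation at each position, and negation is injective, so the images
  -- differ at `i` exactly when `x` and `y` differ at `π ⟨$⟩ʳ i`.
  hamming-signedPermute : ∀ x y → hamming (signedPermute x) (signedPermute y) ≡ hamming x y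
  hamming-signedPermute x y = count-permute π _ _ λ i → mk⇔
    (λ ≢′ eq → ≢′ (trans (lookup-signedPermute x i)
      (trans (cong (negateIf _) eq) (sym (lookup-signedPermute y i)))))
    (λ ≢′ eq → ≢′ (negateIf-injective (lookup c (π ⟨$⟩ʳ i))
      (trans (sym (lookup-signedPermute x i)) (trans eq (lookup-signedPermute y i)))))

  module _ {f g : BoolFun n} (f∘φ≗g : f ∘ signedPermute ≗ g) where

    -- Flipping bit `i` of the image changes `f` exactly when flipping bit `π ⟨$⟩ʳ i` of `x` changes
    -- `g`.
    sensitivity-signedPermute : ∀ x → sensitivity f (signedPermute x) ≡ sensitivity g x
    sensitivity-signedPermute x = count-permute π _ _ λ i →
      let flipped = trans (cong f (flipBit-signedPermute x i)) (f∘φ≗g (flipBit x (π ⟨$⟩ʳ i)))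
      in mk⇔
        (λ ≢′ eq → ≢′ (trans (f∘φ≗g x) (trans eq (sym flipped))))
        (λ ≢′ eq → ≢′ (trans (sym (f∘φ≗g x)) (trans eq flipped)))

    InSD¹-signedPermute : ∀ K x → InSD¹ K g x ⇔ InSD¹ K f (signedPermute x)
    InSD¹-signedPermute K x = mk⇔
      (λ { (s , v) → trans (sensitivity-signedPermute x) s , trans (f∘φ≗g x) v })
      (λ { (s , v) → trans (sym (sensitivity-signedPermute x)) s , trans (sym (f∘φ≗g x)) v })

    ∈-SD¹-signedPermute : ∀ K x → x ∈ SD¹ K g ⇔ signedPermute x ∈ SD¹ K f
    ∈-SD¹-signedPermute K =
      ∈-filter-⇔ (inSD¹? K g) (inSD¹? K f) words-complete words-complete (InSD¹-signedPermute K)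

SD¹-unique : ∀ {n} K (f : BoolFun n) → Unique (SD¹ K f)
SD¹-unique {n} K f = Unique.filter⁺ (inSD¹? K f) (words-unique n)

mainTheorem7 : (n : ℕ) (f g : BoolFun n) (K : ℕ) →
    PNEquivalent f g →
    averageHamming (SD¹ K f) ≡ averageHamming (SD¹ K g)
mainTheorem7 n f g K (π , c , f∘φ≗g) =
  -- The divisor depends only on `n`, so it suffices to equate the two sums of distances.
  cong (λ s → _/_ (+ s) (2 ^ n) {{m^n≢0 2 n}}) (begin
    sum (map (uncurry hamming) (pairs f))
      -- Since `f ∘ φ` is `g`, the map goes from the domain of `g` to that of `f`: the pairs for `f`
      -- are a rearrangement of the images of the pairs for `g`.
      ≡⟨ sum-↭ (map⁺ (uncurry hamming) (cartesianProduct-↔-↭ (signedPermute-↔ π c)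
           (SD¹-unique K g) (SD¹-unique K f) (∈-SD¹-signedPermute π c f∘φ≗g K))) ⟨
    sum (map (uncurry hamming) (map φ×φ (pairs g)))
      ≡⟨ cong sum (map-∘ (pairs g)) ⟨
    sum (map (uncurry hamming ∘ φ×φ) (pairs g))
      ≡⟨ cong sum (map-cong (uncurry (hamming-signedPermute π c)) (pairs g)) ⟩
    sum (map (uncurry hamming) (pairs g)) ∎)
  where
  pairs : BoolFun n → List (Word n × Word n)
  pairs h = cartesianProduct (SD¹ K h) (SD¹ K h)
  φ×φ : Word n × Word n → Word n × Word n
  φ×φ = Inverse.to (signedPermute-↔ π c ×-↔ signedPermute-↔ π c)
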